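{- For all positive integers $n$ and $m$ with $m\ge 2$, $$\hat{r}(2K_2,nP_m)=\min\{nm+1,\,(n+1)(m-1)\}.$$
   Context: All graphs are finite and simple. For graphs $G_1,G_2$, the size Ramsey number $\hat{r}(G_1,G_2)$ is the smallest positive integer $m$ such that there exists a graph $G$ with $m$ edges with the property that for every coloring of the edges of $G$ with red and blue, $G$ contains a red subgraph isomorphic to $G_1$ or a blue subgraph isomorphic to $G_2$. $2K_2$ denotes the matching with two edges. $P_m$ is the path with $m$ vertices, and $nP_m$ is the disjoint union of $n$ copies of $P_m$. -}

module Defs where

open import Data.Nat using (ℕ; zero; suc; _+_; _*_; _∸_; _<_; _≤_; _⊓_)
open import Data.Bool using (Bool; true; false)
open import Data.Fin using (Fin)
open import Data.List using (List; []; _∷_; length; lookup; map; concatMap; upTo)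
open import Data.List.Relation.Unary.All using (All)
open import Data.List.Relation.Unary.Unique.Propositional using (Unique)
open import Data.Product using (_×_; _,_; Σ; ∃)
open import Data.Sum using (_⊎_)
open import Relation.Binary.PropositionalEquality using (_≡_)
open import Relation.Nullary using (¬_)

-- A finite simple (host) graph: vertex set {0,…,V-1}; edges are listed as
-- pairs (a , b) with a < b < V (so no loops, and each unordered pair has a
-- unique representation), without repetitions (no multi-edges).
record Graph : Set where
  field
    V       : ℕ
    E       : List (ℕ × ℕ)
    edgesOk : All (λ e → Data.Product.proj₁ e < Data.Product.proj₂ e
                         × Data.Product.proj₂ e < V) E
    simple  : Unique E

open Graph public

size : Graph → ℕ
size G = length (E G)

-- A pattern graph (used for the small graphs 2K₂ and nPₘ): vertex set
-- {0,…,PV-1} and a list of edges.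
record Pattern : Set where
  field
    PV : ℕ
    PE : List (ℕ × ℕ)

open Pattern public

-- red = true, blue = false; a colouring assigns a colour to each edge of G
Colouring : Graph → Set
Colouring G = Fin (size G) → Bool

HasCopy : (G : Graph) → Colouring G → Bool → Pattern → Set
HasCopy G c col H =
  Σ (ℕ → ℕ) λ f →
      (∀ a → a < PV H → f a < V G)
    × (∀ a b → a < PV H → b < PV H → f a ≡ f b → a ≡ b)
    × All (λ e → ∃ λ (k : Fin (size G)) →
               (lookup (E G) k ≡ (f (Data.Product.proj₁ e) , f (Data.Product.proj₂ e))
                ⊎ lookup (E G) k ≡ (f (Data.Product.proj₂ e) , f (Data.Product.proj₁ e)))
               × c k ≡ col)
          (PE H)

Arrows : Graph → Pattern → Pattern → Set
Arrows G H₁ H₂ = (c : Colouring G) → HasCopy G c true H₁ ⊎ HasCopy G c false H₂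

IsSizeRamsey : Pattern → Pattern → ℕ → Set
IsSizeRamsey H₁ H₂ r =
    (Σ Graph λ G → size G ≡ r × Arrows G H₁ H₂)
  × (∀ (G : Graph) → size G < r → ¬ Arrows G H₁ H₂)

twoK2 : Pattern
twoK2 = record { PV = 4 ; PE = (0 , 1) ∷ (2 , 3) ∷ [] }

nP : ℕ → ℕ → Pattern
nP n m = record
  { PV = n * m
  ; PE = concatMap (λ i → map (λ j → (i * m + j , i * m + suc j)) (upTo (m ∸ 1))) (upTo n)
  }

{-# OPTIONS --safe #-}
module Submission where

-- Upper bound: in a triangle-free host, a red graph without 2K₂ is a star, so it suffices
-- that deleting any vertex leaves nPₘ; this holds for (n+1)Pₘ and for the cycle of length nm + 1.
--
-- Lower bound: colouring the star of v red shows that G − v contains nPₘ for every v.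
-- Suppose that G has no n + 1 disjoint copies of Pₘ and at most nm edges. Repeatedly merge
-- a leaf into its neighbour and drop isolated vertices. The merged pieces ("blobs") stay free
-- of Pₘ: a new Pₘ in the blob of u could be added to a packing of G − u, because that packing
-- cannot enter the blob. The copies of Pₘ in G − v avoid dropped blobs, so more than nm
-- vertices always remain undropped, and there is always another vertex of degree at most one.
-- Hence everything gets peeled off, although G contains Pₘ.

open import Defs
open import Data.Bool using (true; false)
import Data.Bool.Properties as Bool
open import Data.Empty using (⊥-elim)
open import Data.Fin using (Fin; zero; suc; toℕ; remQuot; combine)
open import Data.Fin.Properties using (toℕ<n; toℕ-injective; injective⇒≤; combine-remQuot; any?)
open import Data.List using (List; []; _∷_; length; lookup; map; concatMap; upTo; filter; _++_)
open import Data.List.Properties using (length-++; length-upTo; length-map; filter-notAll; filter-accept; filter-reject)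
open import Data.List.Membership.Propositional using (_∈_; find; lose)
open import Data.List.Membership.Propositional.Properties using (∈-concatMap⁺; ∈-concatMap⁻; ∈-map⁺; ∈-map⁻; ∈-upTo⁺; ∈-upTo⁻; ∈-filter⁺; ∈-filter⁻; ∈-++⁺ˡ; ∈-++⁺ʳ; ∈-lookup)
open import Data.List.Relation.Unary.All as All using (All; []; _∷_)
import Data.List.Relation.Unary.All.Properties as All
open import Data.List.Relation.Unary.AllPairs as AllPairs using ([]; _∷_)
import Data.List.Relation.Unary.AllPairs.Properties as AllPairs
open import Data.List.Relation.Unary.Any as Any using (here; there; index)
open import Data.List.Relation.Unary.Any.Properties using (lookup-index)
open import Data.List.Relation.Unary.Unique.Propositional using (Unique)
import Data.List.Relation.Unary.Unique.Propositional.Properties as Unique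
open import Data.Nat using (ℕ; zero; suc; _+_; _*_; _∸_; _≤_; _<_; _⊓_; z≤n; s≤s; _≟_; _<?_; _≤?_; _/_; >-nonZero)
open import Data.Nat.DivMod using (m/n*n≤m; m≡m%n+[m/n]*n; m%n<n)
open import Data.Nat.Properties hiding (_≟_; _<?_; _≤?_)
open import Data.List.Membership.DecPropositional _≟_ using (_∈?_)
open import Data.Product using (_×_; _,_; Σ; ∃; proj₁; proj₂)
open import Data.Sum using (_⊎_; inj₁; inj₂; [_,_]′; swap)
open import Function using (_∘_)
open import Function.Definitions using (Injective)
open import Relation.Binary.Definitions using (tri<; tri≈; tri>)
open import Relation.Binary.PropositionalEquality using (_≡_; _≢_; refl; sym; trans; cong; cong₂; subst; ≢-sym)
open import Relation.Nullary using (¬_; Dec; yes; no; contradiction; ¬?; does)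
open import Relation.Nullary.Decidable using (_⊎-dec_; _×-dec_; decidable-stable; dec-true; dec-false)

-- Counting entries of lists.

injection⇒≤length : ∀ {N} {f : Fin N → ℕ} {xs} → Injective _≡_ _≡_ f →
  (∀ i → f i ∈ xs) → N ≤ length xs
injection⇒≤length {f = f} {xs} inj f∈xs = injective⇒≤ λ {i} {j} eq →
  inj (trans (lookup-index (f∈xs i))
      (trans (cong (lookup xs) eq) (sym (lookup-index (f∈xs j)))))

remQuot-injective : ∀ {n} k {x y : Fin (n * k)} → remQuot {n} k x ≡ remQuot {n} k y → x ≡ y
remQuot-injective {n} k {x} {y} eq =
  trans (sym (combine-remQuot {n} k x))
        (trans (cong (λ p → combine (proj₁ p) (proj₂ p)) eq) (combine-remQuot {n} k y))

count : ℕ → List ℕ → ℕ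
count v xs = length (filter (v ≟_) xs)

remove : ℕ → List ℕ → List ℕ
remove v = filter (λ x → ¬? (v ≟ x))

∈-remove⁺ : ∀ {v x xs} → v ≢ x → x ∈ xs → x ∈ remove v xs
∈-remove⁺ {v} v≢x x∈ = ∈-filter⁺ (λ x → ¬? (v ≟ x)) x∈ v≢x

∈-remove⁻ : ∀ {v x xs} → x ∈ remove v xs → x ∈ xs × v ≢ x
∈-remove⁻ {v} {xs = xs} = ∈-filter⁻ (λ x → ¬? (v ≟ x)) {xs = xs}

length-remove : ∀ {v xs} → v ∈ xs → length (remove v xs) < length xs
length-remove {v} {xs} v∈ = filter-notAll (λ x → ¬? (v ≟ x)) xs (Any.map (λ eq v≢ → v≢ eq) v∈)

remove-unique : ∀ v {xs} → Unique xs → Unique (remove v xs)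
remove-unique v = Unique.filter⁺ (λ x → ¬? (v ≟ x))

count-≡ : ∀ {v x} xs → v ≡ x → count v (x ∷ xs) ≡ suc (count v xs)
count-≡ {v} xs v≡x = cong length (filter-accept (v ≟_) {xs = xs} v≡x)

count-≢ : ∀ {v x} xs → v ≢ x → count v (x ∷ xs) ≡ count v xs
count-≢ {v} xs v≢x = cong length (filter-reject (v ≟_) {xs = xs} v≢x)

remove-≡ : ∀ {v x} xs → v ≡ x → remove v (x ∷ xs) ≡ remove v xs
remove-≡ {v} xs v≡x = filter-reject (λ x → ¬? (v ≟ x)) {xs = xs} (λ v≢x → v≢x v≡x)

remove-≢ : ∀ {v x} xs → v ≢ x → remove v (x ∷ xs) ≡ x ∷ remove v xs
remove-≢ {v} xs v≢x = filter-accept (λ x → ¬? (v ≟ x)) {xs = xs} v≢x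

count+remove : ∀ v xs → count v xs + length (remove v xs) ≡ length xs
count+remove v [] = refl
count+remove v (x ∷ xs) with v ≟ x
... | yes v≡x rewrite count-≡ xs v≡x | remove-≡ xs v≡x = cong suc (count+remove v xs)
... | no  v≢x rewrite count-≢ xs v≢x | remove-≢ xs v≢x =
  trans (+-suc _ _) (cong suc (count+remove v xs))

count-remove : ∀ {v w} → v ≢ w → ∀ xs → count w (remove v xs) ≡ count w xs
count-remove v≢w [] = refl
count-remove {v} {w} v≢w (x ∷ xs) with v ≟ x
... | yes v≡x rewrite remove-≡ xs v≡x =
  trans (count-remove v≢w xs) (sym (count-≢ xs λ w≡x → v≢w (trans v≡x (sym w≡x))))
... | no v≢x rewrite remove-≢ xs v≢x with w ≟ x
...   | yes w≡x rewrite count-≡ xs w≡x | count-≡ (remove v xs) w≡x = cong suc (count-remove v≢w xs)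
...   | no  w≢x rewrite count-≢ xs w≢x | count-≢ (remove v xs) w≢x = count-remove v≢w xs

-- Removing every occurrence of `a` costs at least two entries of `xs` and leaves the counts of the
-- other, distinct elements unchanged.
twice-each⇒≤length : ∀ {as} → Unique as → ∀ xs → All (λ a → 2 ≤ count a xs) as →
  2 * length as ≤ length xs
twice-each⇒≤length [] xs [] = z≤n
twice-each⇒≤length {a ∷ as} (a∉as ∷ uniq) xs (2≤ ∷ rest) = begin
  2 * suc (length as)                 ≡⟨ *-suc 2 (length as) ⟩
  2 + 2 * length as                   ≤⟨ +-mono-≤ 2≤ (twice-each⇒≤length uniq (remove a xs) rest′) ⟩
  count a xs + length (remove a xs)   ≡⟨ count+remove a xs ⟩
  length xs                           ∎
  where
  open ≤-Reasoning
  rest′ : All (λ b → 2 ≤ count b (remove a xs)) as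
  rest′ = All.map (λ (a≢b , 2≤b) → subst (2 ≤_) (sym (count-remove a≢b xs)) 2≤b)
                  (All.zip (a∉as , rest))

-- Vertices of degree at most one in an edge list.

-- Thus `count v (ends F)` is the degree of `v` in `F`, a loop counting twice.
ends : List (ℕ × ℕ) → List ℕ
ends []            = []
ends ((a , b) ∷ F) = a ∷ b ∷ ends F

length-ends : ∀ F → length (ends F) ≡ 2 * length F
length-ends []      = refl
length-ends (_ ∷ F) = trans (cong (2 +_) (length-ends F)) (sym (*-suc 2 (length F)))

-- Handshake argument: if every vertex of `A` had degree at least 2, then `ends F` would have at
-- least twice as many entries as `A`, but it has only `2 * length F`.
low-degree-vertex : ∀ {A} → Unique A → ∀ F → length F < length A →
  ∃ λ v → v ∈ A × count v (ends F) < 2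
low-degree-vertex {A} uniq F F<A
  with find (All.¬All⇒Any¬ (λ a → 2 ≤? count a (ends F)) A ¬all)
  where
  ¬all : ¬ All (λ a → 2 ≤ count a (ends F)) A
  ¬all all = <⇒≱ F<A (*-cancelˡ-≤ 2
    (≤-trans (twice-each⇒≤length uniq (ends F) all) (≤-reflexive (length-ends F))))
... | v , v∈A , 2≰ = v , v∈A , ≰⇒> 2≰

Isolated : ℕ → List (ℕ × ℕ) → Set
Isolated v = All (λ e → v ≢ proj₁ e × v ≢ proj₂ e)

-- `others` is `F` without the only edge at `v`. That edge may be stored in either order, hence the
-- disjunctions in `edge` and `split`.
record Leaf (v : ℕ) (F : List (ℕ × ℕ)) : Set where
  field
    nbr        : ℕ
    others     : List (ℕ × ℕ)
    v≢nbr      : v ≢ nbr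
    edge       : (v , nbr) ∈ F ⊎ (nbr , v) ∈ F
    length≡    : length F ≡ suc (length others)
    isolated   : Isolated v others
    others⊆    : ∀ {e} → e ∈ others → e ∈ F
    split      : ∀ {e} → e ∈ F → e ∈ others ⊎ (e ≡ (v , nbr) ⊎ e ≡ (nbr , v))

count≡0⇒isolated : ∀ v F → count v (ends F) ≡ 0 → Isolated v F
count≡0⇒isolated v [] _ = []
count≡0⇒isolated v ((a , b) ∷ F) eq with v ≟ a
... | yes v≡a with () ← trans (sym (count-≡ (b ∷ ends F) v≡a)) eq
... | no v≢a rewrite count-≢ (b ∷ ends F) v≢a with v ≟ b
...   | yes v≡b with () ← trans (sym (count-≡ (ends F) v≡b)) eq
...   | no v≢b rewrite count-≢ (ends F) v≢b = (v≢a , v≢b) ∷ count≡0⇒isolated v F eq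

isolated-or-leaf : ∀ v F → count v (ends F) < 2 → Isolated v F ⊎ Leaf v F
isolated-or-leaf v [] _ = inj₁ []
isolated-or-leaf v ((a , b) ∷ F) c<2 with v ≟ a
isolated-or-leaf v ((a , b) ∷ F) c<2 | yes v≡a rewrite count-≡ (b ∷ ends F) v≡a with v ≟ b
-- A loop at `v` would already bring the count to 2.
... | yes v≡b with s≤s (s≤s ()) ← subst (λ c → suc c < 2) (count-≡ (ends F) v≡b) c<2
... | no v≢b rewrite count-≢ (ends F) v≢b = inj₂ record
  { nbr = b ; others = F ; v≢nbr = v≢b ; edge = inj₁ (here (cong (_, b) v≡a)) ; length≡ = refl
  ; isolated = count≡0⇒isolated v F (n<1⇒n≡0 (≤-pred c<2)) ; others⊆ = there
  ; split = λ { (here eq) → inj₂ (inj₁ (trans eq (cong (_, b) (sym v≡a)))) ; (there e∈) → inj₁ e∈ } }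
isolated-or-leaf v ((a , b) ∷ F) c<2 | no v≢a rewrite count-≢ (b ∷ ends F) v≢a with v ≟ b
... | yes v≡b rewrite count-≡ (ends F) v≡b = inj₂ record
  { nbr = a ; others = F ; v≢nbr = v≢a ; edge = inj₂ (here (cong (a ,_) v≡b)) ; length≡ = refl
  ; isolated = count≡0⇒isolated v F (n<1⇒n≡0 (≤-pred c<2)) ; others⊆ = there
  ; split = λ { (here eq) → inj₂ (inj₂ (trans eq (cong (a ,_) (sym v≡b)))) ; (there e∈) → inj₁ e∈ } }
... | no v≢b rewrite count-≢ (ends F) v≢b with isolated-or-leaf v F c<2
...   | inj₁ iso  = inj₁ ((v≢a , v≢b) ∷ iso)
...   | inj₂ leaf = inj₂ record
  { nbr = nbr ; others = (a , b) ∷ others ; v≢nbr = v≢nbr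
  ; edge = [ inj₁ ∘ there , inj₂ ∘ there ]′ edge ; length≡ = cong suc length≡
  ; isolated = (v≢a , v≢b) ∷ isolated
  ; others⊆ = λ { (here eq) → here eq ; (there e∈) → there (others⊆ e∈) }
  ; split = λ { (here eq) → inj₁ (here eq)
              ; (there e∈) → [ inj₁ ∘ there , inj₂ ]′ (split e∈) } }
  where open Leaf leaf

-- Paths and packings

Adj : Graph → ℕ → ℕ → Set
Adj G x y = ∃ λ (k : Fin (size G)) → lookup (E G) k ≡ (x , y) ⊎ lookup (E G) k ≡ (y , x)

Adj-sym : ∀ G {x y} → Adj G x y → Adj G y x
Adj-sym G (k , inj₁ eq) = k , inj₂ eq
Adj-sym G (k , inj₂ eq) = k , inj₁ eq

same-edge : ∀ {p : ℕ × ℕ} {x y x′ y′} → p ≡ (x , y) ⊎ p ≡ (y , x) → p ≡ (x′ , y′) ⊎ p ≡ (y′ , x′) →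
  (x ≡ x′ × y ≡ y′) ⊎ (x ≡ y′ × y ≡ x′)
same-edge (inj₁ refl) (inj₁ refl) = inj₁ (refl , refl)
same-edge (inj₁ refl) (inj₂ refl) = inj₂ (refl , refl)
same-edge (inj₂ refl) (inj₁ refl) = inj₂ (refl , refl)
same-edge (inj₂ refl) (inj₂ refl) = inj₁ (refl , refl)

-- A copy of nPₘ regardless of colours, indexed by path and position so that single paths can be
-- handled and added.
record Packing (G : Graph) (n m : ℕ) : Set where
  field
    path      : ℕ → ℕ → ℕ
    injective : ∀ {i j i′ j′} → i < n → j < m → i′ < n → j′ < m →
                path i j ≡ path i′ j′ → i ≡ i′ × j ≡ j′
    adjacent  : ∀ {i j} → i < n → suc j < m → Adj G (path i j) (path i (suc j))

-- Each of the n paths has k edges, and sending them to their positions in `E G` is injective.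
packing⇒size : ∀ G n k → Packing G n (suc k) → n * k ≤ size G
packing⇒size G n k P = injective⇒≤ {f = edge} edge-injective
  where
  open Packing P
  adj : ∀ (x : Fin (n * k)) → let (i , j) = remQuot {n} k x in
        Adj G (path (toℕ i) (toℕ j)) (path (toℕ i) (suc (toℕ j)))
  adj x = adjacent (toℕ<n (proj₁ (remQuot {n} k x))) (s≤s (toℕ<n (proj₂ (remQuot {n} k x))))

  edge : Fin (n * k) → Fin (size G)
  edge x = proj₁ (adj x)

  edge-injective : Injective _≡_ _≡_ edge
  edge-injective {x} {y} eq = remQuot-injective {n} k
    (cong₂ _,_ (toℕ-injective (proj₁ ij≡)) (toℕ-injective (proj₂ ij≡)))
    where
    i  = proj₁ (remQuot {n} k x)
    j  = proj₂ (remQuot {n} k x)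
    i′ = proj₁ (remQuot {n} k y)
    j′ = proj₂ (remQuot {n} k y)
    j<  = m<n⇒m<1+n (toℕ<n j)
    j′< = m<n⇒m<1+n (toℕ<n j′)
    ij≡ : toℕ i ≡ toℕ i′ × toℕ j ≡ toℕ j′
    ij≡ with same-edge (subst (λ e → lookup (E G) e ≡ _ ⊎ lookup (E G) e ≡ _) eq (proj₂ (adj x)))
                       (proj₂ (adj y))
    ... | inj₁ (same , _) = injective (toℕ<n i) j< (toℕ<n i′) j′< same
    -- If the same edge were used in opposite directions, then j + 1 = j′ and j = j′ + 1.
    ... | inj₂ (cross₁ , cross₂) =
      contradiction (proj₂ (injective (toℕ<n i) (s≤s (toℕ<n j)) (toℕ<n i′) j′< cross₂))
        λ 1+j≡j′ → <-asym (≤-reflexive 1+j≡j′)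
          (≤-reflexive (sym (proj₂ (injective (toℕ<n i) j< (toℕ<n i′) (s≤s (toℕ<n j′)) cross₁))))

-- Connectedness of a path: go down from i to position 0, then up to j.
along-path : ∀ {m} (Q : ℕ → Set) →
  (∀ j → suc j < m → Q j → Q (suc j)) → (∀ j → suc j < m → Q (suc j) → Q j) →
  ∀ {i} → i < m → Q i → ∀ {j} → j < m → Q j
along-path {m} Q up down i<m qi = ascend _ (descend _ i<m qi)
  where
  descend : ∀ i → i < m → Q i → Q 0
  descend zero    _   q = q
  descend (suc i) i<m q = descend i (<-trans (n<1+n i) i<m) (down i i<m q)
  ascend : ∀ j → Q 0 → j < m → Q j
  ascend zero    q _   = q
  ascend (suc j) q j<m = up j j<m (ascend j q (<-trans (n<1+n j) j<m))

record IsPath (G : Graph) (m : ℕ) (p : ℕ → ℕ) : Set where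
  field
    injective : ∀ {j j′} → j < m → j′ < m → p j ≡ p j′ → j ≡ j′
    adjacent  : ∀ {j} → suc j < m → Adj G (p j) (p (suc j))

component : ∀ {G n m} (P : Packing G n m) {i} → i < n → IsPath G m (Packing.path P i)
component P i<n = record
  { injective = λ j< j′< eq → proj₂ (Packing.injective P i<n j< i<n j′< eq)
  ; adjacent  = Packing.adjacent P i<n }

extend : ∀ {G n m p} (P : Packing G n m) → IsPath G m p →
  (∀ {i j j′} → i < n → j < m → j′ < m → Packing.path P i j ≢ p j′) → Packing G (suc n) m
extend {G} {n} {m} {p} P isPath disjoint = record { path = q ; injective = inj ; adjacent = adj }
  where
  q : ℕ → ℕ → ℕ
  q zero    = p
  q (suc i) = Packing.path P i
  inj : ∀ {i j i′ j′} → i < suc n → j < m → i′ < suc n → j′ < m → q i j ≡ q i′ j′ → i ≡ i′ × j ≡ j′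
  inj {zero}  {i′ = zero}   _ j< _ j′< eq = refl , IsPath.injective isPath j< j′< eq
  inj {zero}  {i′ = suc _}  _ j< (s≤s i′<) j′< eq = contradiction (sym eq) (disjoint i′< j′< j<)
  inj {suc _} {i′ = zero}   (s≤s i<) j< _ j′< eq = contradiction eq (disjoint i< j< j′<)
  inj {suc _} {i′ = suc _}  (s≤s i<) j< (s≤s i′<) j′< eq
    with Packing.injective P i< j< i′< j′< eq
  ... | refl , j≡ = refl , j≡
  adj : ∀ {i j} → i < suc n → suc j < m → Adj G (q i j) (q i (suc j))
  adj {zero}  _        = IsPath.adjacent isPath
  adj {suc _} (s≤s i<) = Packing.adjacent P i<

-- What the star colouring at `v` yields; `bounded` is there so that `covered` applies to the
-- vertices of the packing.
record PackingAvoiding (G : Graph) (n m v : ℕ) : Set where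
  field
    packing : Packing G n m
  open Packing packing public
  field
    bounded : ∀ {i j} → i < n → j < m → path i j < V G
    avoids  : ∀ {i j} → i < n → j < m → path i j ≢ v

-- Peeling off leaves

-- Peeled leaves are merged into the vertex they hung from: root sends every vertex
-- to the representative of its blob, A lists the surviving representatives, F the
-- edges between them, and L the peeled vertices.
record Peeling (G : Graph) (m : ℕ) (A L : List ℕ) (F : List (ℕ × ℕ)) : Set where
  field
    root      : ℕ → ℕ
    root-A    : ∀ {a} → a ∈ A → root a ≡ a
    F⊆A×A     : ∀ {x y} → (x , y) ∈ F → x ∈ A × y ∈ A
    adj-root  : ∀ {x y} → Adj G x y →
                root x ≡ root y ⊎ (root x ≡ x × root y ≡ y × ((x , y) ∈ F ⊎ (y , x) ∈ F))
    no-path   : ∀ w {p} → IsPath G m p → ¬ (∀ {j} → j < m → root (p j) ≡ w)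
    covered   : ∀ {x} → x < V G → root x ∈ A → x ∈ A ⊎ x ∈ L

module _ {G : Graph} {m : ℕ} {A L : List ℕ} {F : List (ℕ × ℕ)} (S : Peeling G m A L F) where
  open Peeling S

  F-ends∈A : ∀ {x y} → (x , y) ∈ F ⊎ (y , x) ∈ F → x ∈ A × y ∈ A
  F-ends∈A (inj₁ xy∈F) = F⊆A×A xy∈F
  F-ends∈A (inj₂ yx∈F) = proj₂ (F⊆A×A yx∈F) , proj₁ (F⊆A×A yx∈F)

  -- A path that meets a blob and cannot leave it along its own edges lies entirely inside it,
  -- against `no-path`.
  ¬closed-blob : ∀ {p w i} → IsPath G m p →
    (∀ {j j′} → j < m → j′ < m → Adj G (p j) (p j′) → root (p j) ≡ w → root (p j′) ≡ w) →
    i < m → root (p i) ≢ w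
  ¬closed-blob {p} {w} isPath closed i< eq = no-path w isPath
    (along-path (λ j → root (p j) ≡ w)
      (λ j j< → closed (<-trans (n<1+n j) j<) j< (adjacent j<))
      (λ j j< → closed j< (<-trans (n<1+n j) j<) (Adj-sym G (adjacent j<)))
      i< eq)
    where open IsPath isPath

  -- Edges between different blobs join representatives in `A`. Hence no edge leaves a dropped blob,
  -- and a path meeting it would stay inside.
  path-root∈A : ∀ {p i} → IsPath G m p → i < m → root (p i) ∈ A
  path-root∈A {p} {i} isPath i< with root (p i) ∈? A
  ... | yes r∈A = r∈A
  ... | no  r∉A = contradiction refl (¬closed-blob isPath closed i<)
    where
    closed : ∀ {j j′} → j < m → j′ < m → Adj G (p j) (p j′) →
             root (p j) ≡ root (p i) → root (p j′) ≡ root (p i)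
    closed _ _ adj eq with adj-root adj
    ... | inj₁ same = trans (sym same) eq
    ... | inj₂ (rx , _ , xy∈F) =
      contradiction (subst (_∈ A) (trans (sym rx) eq) (proj₁ (F-ends∈A xy∈F))) r∉A

  -- The n m vertices of the packing have roots in `A`, hence lie in `A` or `L`; `v` is one more,
  -- since the packing avoids it.
  survivors≥ : ∀ {n v} → v ∈ A → PackingAvoiding G n m v → n * m < length A + length L
  survivors≥ {n} {v} v∈A P =
    subst (n * m <_) (length-++ A) (injection⇒≤length {f = f} f-injective f∈)
    where
    open PackingAvoiding P
    vertex : Fin (n * m) → ℕ
    vertex x = path (toℕ (proj₁ (remQuot {n} m x))) (toℕ (proj₂ (remQuot {n} m x)))
    f : Fin (suc (n * m)) → ℕ
    f zero    = v
    f (suc x) = vertex x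
    f-injective : Injective _≡_ _≡_ f
    f-injective {zero}  {zero}  _  = refl
    f-injective {zero}  {suc y} eq = contradiction (sym eq)
      (avoids (toℕ<n (proj₁ (remQuot {n} m y))) (toℕ<n (proj₂ (remQuot {n} m y))))
    f-injective {suc x} {zero}  eq = contradiction eq
      (avoids (toℕ<n (proj₁ (remQuot {n} m x))) (toℕ<n (proj₂ (remQuot {n} m x))))
    f-injective {suc x} {suc y} eq
      with injective (toℕ<n (proj₁ (remQuot {n} m x))) (toℕ<n (proj₂ (remQuot {n} m x)))
                     (toℕ<n (proj₁ (remQuot {n} m y))) (toℕ<n (proj₂ (remQuot {n} m y))) eq
    ... | i≡ , j≡ = cong suc (remQuot-injective {n} m (cong₂ _,_ (toℕ-injective i≡) (toℕ-injective j≡)))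
    f∈ : ∀ x → f x ∈ A ++ L
    f∈ zero    = ∈-++⁺ˡ v∈A
    f∈ (suc x) = [ ∈-++⁺ˡ , ∈-++⁺ʳ A ]′
      (covered (bounded i< j<) (path-root∈A (component packing i<) j<))
      where
      i< = toℕ<n (proj₁ (remQuot {n} m x))
      j< = toℕ<n (proj₂ (remQuot {n} m x))

  -- `root` does not change: the blob of `v` counts as dropped because its root is no longer in `A`.
  drop-isolated : ∀ {v} → Isolated v F → Peeling G m (remove v A) L F
  drop-isolated {v} iso = record
    { root     = root
    ; root-A   = root-A ∘ proj₁ ∘ ∈-remove⁻
    ; F⊆A×A    = λ xy∈F → ∈-remove⁺ (proj₁ (All.lookup iso xy∈F)) (proj₁ (F⊆A×A xy∈F))
                        , ∈-remove⁺ (proj₂ (All.lookup iso xy∈F)) (proj₂ (F⊆A×A xy∈F))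
    ; adj-root = adj-root
    ; no-path  = no-path
    ; covered  = covered′
    }
    where
    covered′ : ∀ {x} → x < V G → root x ∈ remove v A → x ∈ remove v A ⊎ x ∈ L
    covered′ x< r∈ with covered x< (proj₁ (∈-remove⁻ r∈))
    ... | inj₂ x∈L = inj₂ x∈L
    ... | inj₁ x∈A = inj₁ (subst (_∈ remove v A) (root-A x∈A) r∈)

  module _ {n v : ℕ} (leaf : Leaf v F) where
    open Leaf leaf renaming (nbr to u)

    private
      v∈A : v ∈ A
      v∈A = proj₁ (F-ends∈A edge)

      split-adj : ∀ {x y} → (x , y) ∈ F ⊎ (y , x) ∈ F →
        ((x , y) ∈ others ⊎ (y , x) ∈ others) ⊎ ((x ≡ v × y ≡ u) ⊎ (x ≡ u × y ≡ v))
      split-adj (inj₁ xy∈F) with split xy∈F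
      ... | inj₁ xy∈         = inj₁ (inj₁ xy∈)
      ... | inj₂ (inj₁ refl) = inj₂ (inj₁ (refl , refl))
      ... | inj₂ (inj₂ refl) = inj₂ (inj₂ (refl , refl))
      split-adj (inj₂ yx∈F) with split yx∈F
      ... | inj₁ yx∈         = inj₁ (inj₂ yx∈)
      ... | inj₂ (inj₁ refl) = inj₂ (inj₂ (refl , refl))
      ... | inj₂ (inj₂ refl) = inj₂ (inj₁ (refl , refl))

      others-≢v : ∀ {x y} → (x , y) ∈ others ⊎ (y , x) ∈ others → v ≢ x × v ≢ y
      others-≢v (inj₁ xy∈) = All.lookup isolated xy∈
      others-≢v (inj₂ yx∈) = proj₂ (All.lookup isolated yx∈) , proj₁ (All.lookup isolated yx∈)

    -- Deleting u separates the blob of v and the rest of the blob of u from the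
    -- remaining graph, and neither piece contains a path.
    avoids-merged-blob : (P : PackingAvoiding G n m u) → let open PackingAvoiding P in
      ∀ {i j} → i < n → j < m → root (path i j) ≢ u × root (path i j) ≢ v
    avoids-merged-blob P {i} i< j< =
        ¬closed-blob (component packing i<) closed-u j<
      , ¬closed-blob (component packing i<) closed-v j<
      where
      open PackingAvoiding P
      closed-u : ∀ {j j′} → j < m → j′ < m → Adj G (path i j) (path i j′) →
                 root (path i j) ≡ u → root (path i j′) ≡ u
      closed-u j< _ adj eq with adj-root adj
      ... | inj₁ same        = trans (sym same) eq
      -- A path leaves the blob of `u` only at its representative, which is `u` itself.
      ... | inj₂ (rx , _ , _) = contradiction (trans (sym rx) eq) (avoids i< j<)
      closed-v : ∀ {j j′} → j < m → j′ < m → Adj G (path i j) (path i j′) →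
                 root (path i j) ≡ v → root (path i j′) ≡ v
      closed-v j< j′< adj eq with adj-root adj
      ... | inj₁ same = trans (sym same) eq
      ... | inj₂ (rx , _ , xy∈F) with split-adj xy∈F
      ...   | inj₁ xy∈             = contradiction (trans (sym eq) rx) (proj₁ (others-≢v xy∈))
      ...   | inj₂ (inj₁ (_ , y≡u)) = contradiction y≡u (avoids i< j′<)
      ...   | inj₂ (inj₂ (x≡u , _)) = contradiction x≡u (avoids i< j<)

    private
      merge : ℕ → ℕ
      merge r with r ≟ v
      ... | yes _ = u
      ... | no  _ = r

      merge-v : merge v ≡ u
      merge-v with v ≟ v
      ... | yes _  = refl
      ... | no v≢v = contradiction refl v≢v

      merge-≢v : ∀ {r} → v ≢ r → merge r ≡ r
      merge-≢v {r} v≢r with r ≟ v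
      ... | yes r≡v = contradiction (sym r≡v) v≢r
      ... | no  _   = refl

      merge-inverse : ∀ r → r ≡ merge r ⊎ (r ≡ v × merge r ≡ u)
      merge-inverse r with r ≟ v
      ... | yes r≡v = inj₂ (r≡v , refl)
      ... | no  _   = inj₁ refl

    -- The delicate invariant is `no-path`: a path inside the blob merged from those of `u` and `v`
    -- would be disjoint from `P` and give n + 1 disjoint paths.
    peel-leaf : PackingAvoiding G n m u → ¬ Packing G (suc n) m →
      Peeling G m (remove v A) (v ∷ L) others
    peel-leaf P ¬packing = record
      { root     = merge ∘ root
      ; root-A   = λ a∈ → let (a∈A , v≢a) = ∈-remove⁻ a∈ in
                   trans (cong merge (root-A a∈A)) (merge-≢v v≢a)
      ; F⊆A×A    = λ xy∈ → let (x∈A , y∈A) = F⊆A×A (others⊆ xy∈)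
                               (v≢x , v≢y) = All.lookup isolated xy∈ in
                   ∈-remove⁺ v≢x x∈A , ∈-remove⁺ v≢y y∈A
      ; adj-root = adj-root′
      ; no-path  = no-path′
      ; covered  = covered′
      }
      where
      open PackingAvoiding P

      adj-root′ : ∀ {x y} → Adj G x y → merge (root x) ≡ merge (root y) ⊎
        (merge (root x) ≡ x × merge (root y) ≡ y × ((x , y) ∈ others ⊎ (y , x) ∈ others))
      adj-root′ adj with adj-root adj
      ... | inj₁ same = inj₁ (cong merge same)
      ... | inj₂ (rx , ry , xy∈F) with split-adj xy∈F
      ...   | inj₁ xy∈ = inj₂ ( trans (cong merge rx) (merge-≢v (proj₁ (others-≢v xy∈)))
                              , trans (cong merge ry) (merge-≢v (proj₂ (others-≢v xy∈))) , xy∈)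
      -- The peeled edge between `v` and `u` becomes internal to the merged blob.
      ...   | inj₂ (inj₁ (refl , refl)) = inj₁ (trans (trans (cong merge rx) merge-v)
                                                 (sym (trans (cong merge ry) (merge-≢v v≢nbr))))
      ...   | inj₂ (inj₂ (refl , refl)) = inj₁ (trans (trans (cong merge rx) (merge-≢v v≢nbr))
                                                 (sym (trans (cong merge ry) merge-v)))

      no-path′ : ∀ w {p} → IsPath G m p → ¬ (∀ {j} → j < m → merge (root (p j)) ≡ w)
      no-path′ w {p} isPath in-w with w ≟ u
      -- Blobs other than that of `u` are unchanged by the merge.
      ... | no w≢u = no-path w isPath λ {j} j< →
        [ (λ eq → trans eq (in-w j<)) , (λ (_ , eq) → contradiction (trans (sym (in-w j<)) eq) w≢u) ]′
          (merge-inverse (root (p j)))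
      ... | yes refl = ¬packing (extend packing isPath disjoint)
        where
        disjoint : ∀ {i j j′} → i < n → j < m → j′ < m → path i j ≢ p j′
        disjoint {i} {j} {j′} i< j< j′< eq with avoids-merged-blob P i< j< | merge-inverse (root (p j′))
        ... | ≢u , _  | inj₁ r≡       = ≢u (trans (cong root eq) (trans r≡ (in-w j′<)))
        ... | _  , ≢v | inj₂ (r≡v , _) = ≢v (trans (cong root eq) r≡v)

      covered′ : ∀ {x} → x < V G → merge (root x) ∈ remove v A → x ∈ remove v A ⊎ x ∈ v ∷ L
      covered′ {x} x< r∈ with covered x< root∈A
        where
        root∈A : root x ∈ A
        root∈A with merge-inverse (root x)
        ... | inj₁ r≡       = subst (_∈ A) (sym r≡) (proj₁ (∈-remove⁻ r∈))
        ... | inj₂ (r≡v , _) = subst (_∈ A) (sym r≡v) v∈A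
      ... | inj₂ x∈L = inj₂ (there x∈L)
      ... | inj₁ x∈A with v ≟ x
      ...   | yes refl = inj₂ (here refl)
      ...   | no  v≢x  = inj₁ (∈-remove⁺ v≢x x∈A)

module _ {G : Graph} {n m : ℕ} (1≤n : 1 ≤ n) (1≤m : 1 ≤ m)
         (avoiding : ∀ v → PackingAvoiding G n m v) (¬packing : ¬ Packing G (suc n) m) where

  -- Peeling a leaf moves one unit from `length F` to `length L`, and dropping changes neither, so
  -- their sum stays at most n m. As `length A + length L` exceeds n m, `F` is always shorter than
  -- `A`. `fuel` bounds the length of the shrinking list `A`.
  peel-completely : ∀ fuel {A L F} → length A ≤ fuel → Unique A → Peeling G m A L F →
    ¬ (length F + length L ≤ n * m)
  peel-completely _ {[]} _ _ S _
    -- With `A` empty, the roots of the vertices of a packed path have nowhere to lie.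
    with () ← path-root∈A S (component (PackingAvoiding.packing (avoiding 0)) 1≤n) 1≤m
  peel-completely (suc fuel) {A@(a ∷ _)} {L} {F} A≤ uniq S few
    with low-degree-vertex uniq F (+-cancelʳ-< (length L) (length F) (length A)
           (≤-<-trans few (survivors≥ S (here refl) (avoiding a))))
  ... | v , v∈A , deg<2 with isolated-or-leaf v F deg<2
  ...   | inj₁ iso  = peel-completely fuel (≤-pred (≤-trans (length-remove v∈A) A≤))
                        (remove-unique v uniq) (drop-isolated S iso) few
  ...   | inj₂ leaf = peel-completely fuel (≤-pred (≤-trans (length-remove v∈A) A≤))
                        (remove-unique v uniq) (peel-leaf S leaf (avoiding _) ¬packing)
                        (subst (_≤ n * m) (trans (cong (_+ length L) (Leaf.length≡ leaf))
                                                 (sym (+-suc _ _))) few)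

edge-bounded : ∀ G {x y} → (x , y) ∈ E G → x < V G × y < V G
edge-bounded G xy∈ with All.lookup (edgesOk G) xy∈
... | x<y , y<V = <-trans x<y y<V , y<V

-- Blobs start as single vertices; positions 0 and 1 of a path with m ≥ 2 already need two.
initial-peeling : ∀ G {m} → 2 ≤ m → Peeling G m (upTo (V G)) [] (E G)
initial-peeling G 2≤m = record
  { root     = λ x → x
  ; root-A   = λ _ → refl
  ; F⊆A×A    = λ xy∈ → let (x< , y<) = edge-bounded G xy∈ in ∈-upTo⁺ x< , ∈-upTo⁺ y<
  ; adj-root = λ { (k , inj₁ eq) → inj₂ (refl , refl , inj₁ (subst (_∈ E G) eq (∈-lookup k)))
                 ; (k , inj₂ eq) → inj₂ (refl , refl , inj₂ (subst (_∈ E G) eq (∈-lookup k))) }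
  ; no-path  = λ w isPath in-w → contradiction
      (IsPath.injective isPath (≤-trans (s≤s z≤n) 2≤m) 2≤m
        (trans (in-w (≤-trans (s≤s z≤n) 2≤m)) (sym (in-w 2≤m)))) λ ()
  ; covered  = λ x< _ → inj₁ (∈-upTo⁺ x<)
  }

-- Star colourings and the lower bound.

Touches : ℕ → ℕ × ℕ → Set
Touches v e = v ≡ proj₁ e ⊎ v ≡ proj₂ e

touches? : ∀ v e → Dec (Touches v e)
touches? v e = (v ≟ proj₁ e) ⊎-dec (v ≟ proj₂ e)

star : (G : Graph) → ℕ → Colouring G
star G v k = does (touches? v (lookup (E G) k))

star-red : ∀ G v k → star G v k ≡ true → Touches v (lookup (E G) k)
star-red G v k red = decidable-stable (touches? v (lookup (E G) k))
  λ ¬t → contradiction (trans (sym red) (dec-false (touches? v (lookup (E G) k)) ¬t)) λ ()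

star-blue : ∀ G v k → star G v k ≡ false → ¬ Touches v (lookup (E G) k)
star-blue G v k blue t =
  contradiction (trans (sym blue) (dec-true (touches? v (lookup (E G) k)) t)) λ ()

touches-copy : ∀ {v p x y} → p ≡ (x , y) ⊎ p ≡ (y , x) → Touches v p → v ≡ x ⊎ v ≡ y
touches-copy (inj₁ refl) t        = t
touches-copy (inj₂ refl) (inj₁ e) = inj₂ e
touches-copy (inj₂ refl) (inj₂ e) = inj₁ e

touches-copy⁻ : ∀ {v p x y} → p ≡ (x , y) ⊎ p ≡ (y , x) → v ≡ x ⊎ v ≡ y → Touches v p
touches-copy⁻ (inj₁ refl) t        = t
touches-copy⁻ (inj₂ refl) (inj₁ e) = inj₂ e
touches-copy⁻ (inj₂ refl) (inj₂ e) = inj₁ e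

-- Both red edges would contain `v`, but their endpoints are four different vertices.
star-¬2K2 : ∀ G v → ¬ HasCopy G (star G v) true twoK2
star-¬2K2 G v (f , _ , inj , (k , ends₁ , red₁) ∷ (l , ends₂ , red₂) ∷ [])
  with touches-copy ends₁ (star-red G v k red₁) | touches-copy ends₂ (star-red G v l red₂)
... | inj₁ a | inj₁ b = contradiction (inj 0 2 (s≤s z≤n) (s≤s (s≤s (s≤s z≤n))) (trans (sym a) b)) λ ()
... | inj₁ a | inj₂ b = contradiction (inj 0 3 (s≤s z≤n) (s≤s (s≤s (s≤s (s≤s z≤n)))) (trans (sym a) b)) λ ()
... | inj₂ a | inj₁ b = contradiction (inj 1 2 (s≤s (s≤s z≤n)) (s≤s (s≤s (s≤s z≤n))) (trans (sym a) b)) λ ()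
... | inj₂ a | inj₂ b = contradiction (inj 1 3 (s≤s (s≤s z≤n)) (s≤s (s≤s (s≤s (s≤s z≤n)))) (trans (sym a) b)) λ ()

∈-nP⁺ : ∀ {n k i j} → i < n → j < k → (i * suc k + j , i * suc k + suc j) ∈ PE (nP n (suc k))
∈-nP⁺ i< j< = ∈-concatMap⁺ _ (lose (∈-upTo⁺ i<) (∈-map⁺ _ (∈-upTo⁺ j<)))

index-bounded : ∀ {n m i j} → i < n → j < m → i * m + j < n * m
index-bounded {n} {m} {i} {j} i< j< = begin-strict
  i * m + j ≡⟨ +-comm (i * m) j ⟩
  j + i * m <⟨ +-monoˡ-< (i * m) j< ⟩
  suc i * m ≤⟨ *-monoˡ-≤ m i< ⟩
  n * m     ∎
  where open ≤-Reasoning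

index-ordered : ∀ {m i j i′} j′ → j < m → i < i′ → i * m + j < i′ * m + j′
index-ordered {m} {i} {j} {i′} j′ j< i<i′ =
  <-≤-trans (index-bounded i<i′ j<) (m≤m+n (i′ * m) j′)

index-injective : ∀ {m i j i′ j′} → j < m → j′ < m → i * m + j ≡ i′ * m + j′ → i ≡ i′ × j ≡ j′
index-injective {m} {i} {j} {i′} {j′} j< j′< eq with <-cmp i i′
... | tri< i<i′ _ _ = contradiction eq (<⇒≢ (index-ordered j′ j< i<i′))
... | tri> _ _ i′<i = contradiction (sym eq) (<⇒≢ (index-ordered j j′< i′<i))
... | tri≈ _ refl _ = refl , +-cancelˡ-≡ (i * m) j j′ eq

-- The copy must be blue. As k ≥ 1, each of its vertices lies on a blue edge, and no blue edge
-- contains `v`.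
arrows⇒avoiding : ∀ G n k → 1 ≤ k → Arrows G twoK2 (nP n (suc k)) →
  ∀ v → PackingAvoiding G n (suc k) v
arrows⇒avoiding G n k 1≤k arrows v with arrows (star G v)
... | inj₁ red = contradiction red (star-¬2K2 G v)
... | inj₂ (f , f<V , inj , blue) = record
  { packing = record
    { path      = λ i j → f (i * suc k + j)
    ; injective = λ i< j< i′< j′< eq → index-injective j< j′<
        (inj _ _ (index-bounded i< j<) (index-bounded i′< j′<) eq)
    ; adjacent  = λ i< j< → let (e , ends≡ , _) = edge i< (≤-pred j<) in e , ends≡
    }
  ; bounded = λ i< j< → f<V _ (index-bounded i< j<)
  ; avoids  = avoids
  }
  where
  edge : ∀ {i j} → i < n → j < k → ∃ λ (e : Fin (size G)) →
    (lookup (E G) e ≡ (f (i * suc k + j) , f (i * suc k + suc j))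
      ⊎ lookup (E G) e ≡ (f (i * suc k + suc j) , f (i * suc k + j)))
    × star G v e ≡ false
  edge i< j< = All.lookup blue (∈-nP⁺ i< j<)
  avoids : ∀ {i j} → i < n → j < suc k → f (i * suc k + j) ≢ v
  -- The first vertex of a path uses the edge to its successor, every other vertex the edge from its
  -- predecessor.
  avoids {j = zero} i< _ eq with edge i< 1≤k
  ... | e , ends≡ , c≡ = star-blue G v e c≡ (touches-copy⁻ ends≡ (inj₁ (sym eq)))
  avoids {j = suc j} i< j< eq with edge i< (≤-pred j<)
  ... | e , ends≡ , c≡ = star-blue G v e c≡ (touches-copy⁻ ends≡ (inj₂ (sym eq)))

-- `few₂` excludes n + 1 disjoint paths, which need (n + 1) k edges; `few₁` starts the peeling,
-- where `L` is empty.
lower-bound : ∀ G n k → 1 ≤ n → 1 ≤ k → size G ≤ n * suc k → size G < suc n * k →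
  ¬ Arrows G twoK2 (nP n (suc k))
lower-bound G n k 1≤n 1≤k few₁ few₂ arrows =
  peel-completely 1≤n (s≤s z≤n) (arrows⇒avoiding G n k 1≤k arrows)
    (λ P → <⇒≱ few₂ (packing⇒size G (suc n) k P))
    (V G) (≤-reflexive (length-upTo (V G))) (Unique.upTo⁺ (V G)) (initial-peeling G (s≤s 1≤k))
    (subst (_≤ n * suc k) (sym (+-identityʳ _)) few₁)

-- Intersecting edge sets in triangle-free graphs

-- The endpoints of an edge of a path 0, 1, 2, …, or of the chord closing it to a cycle.
Near : ℕ → ℕ → ℕ → Set
Near M x y = y ≡ suc x ⊎ (x ≡ 0 × y ≡ M)

Near± : ℕ → ℕ → ℕ → Set
Near± M x y = Near M x y ⊎ Near M y x

orient : ∀ {M x y} → x < y → Near± M x y → Near M x y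
orient x<y (inj₁ near) = near
orient x<y (inj₂ (inj₁ refl)) = contradiction x<y (<-asym (n<1+n _))
orient () (inj₂ (inj₂ (refl , _)))

-- Since b lies strictly between a and c, the edge ac must be the chord, so a = 0 and c = M. The
-- other two edges are then unit steps, which forces M = 2.
sorted-triangle-free : ∀ {M a b c} → 3 ≤ M → a < b → b < c →
  Near± M a b → Near± M b c → ¬ Near± M a c
sorted-triangle-free 3≤M a<b b<c ab bc ac with orient (<-trans a<b b<c) ac
... | inj₁ refl = <⇒≱ b<c a<b
... | inj₂ (refl , refl) with orient a<b ab
...   | inj₂ (_ , refl) = <-irrefl refl b<c
...   | inj₁ refl with orient b<c bc
...     | inj₁ refl with s≤s (s≤s ()) ← 3≤M

Near±-irrefl : ∀ {M x} → 3 ≤ M → ¬ Near± M x x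
Near±-irrefl 3≤M near with [ (λ p → p) , (λ p → p) ]′ near
... | inj₁ eq = 1+n≢n (sym eq)
Near±-irrefl () near | inj₂ (refl , refl)

triangle-free : ∀ {M a b c} → 3 ≤ M → Near± M a b → Near± M b c → ¬ Near± M a c
triangle-free {a = a} {b} {c} 3≤M ab bc ac with <-cmp a b | <-cmp b c | <-cmp a c
... | tri≈ _ refl _ | _ | _ = Near±-irrefl 3≤M ab
... | _ | tri≈ _ refl _ | _ = Near±-irrefl 3≤M bc
... | _ | _ | tri≈ _ refl _ = Near±-irrefl 3≤M ac
... | tri< a<b _ _ | tri< b<c _ _ | _ = sorted-triangle-free 3≤M a<b b<c ab bc ac
... | tri< a<b _ _ | tri> _ _ c<b | tri< a<c _ _ = sorted-triangle-free 3≤M a<c c<b ac (swap bc) ab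
... | tri< a<b _ _ | tri> _ _ c<b | tri> _ _ c<a = sorted-triangle-free 3≤M c<a a<b (swap ac) ab (swap bc)
... | tri> _ _ b<a | tri> _ _ c<b | _ = sorted-triangle-free 3≤M c<b b<a (swap bc) (swap ab) (swap ac)
... | tri> _ _ b<a | tri< b<c _ _ | tri< a<c _ _ = sorted-triangle-free 3≤M b<a a<c (swap ab) ac bc
... | tri> _ _ b<a | tri< b<c _ _ | tri> _ _ c<a = sorted-triangle-free 3≤M b<c c<a bc (swap ac) (swap ab)

touches-both : ∀ {x y e} → x ≢ y → Touches x e → Touches y e → e ≡ (x , y) ⊎ e ≡ (y , x)
touches-both x≢y (inj₁ refl) (inj₁ refl) = contradiction refl x≢y
touches-both x≢y (inj₁ refl) (inj₂ refl) = inj₁ refl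
touches-both x≢y (inj₂ refl) (inj₁ refl) = inj₂ refl
touches-both x≢y (inj₂ refl) (inj₂ refl) = contradiction refl x≢y

Meets : ℕ × ℕ → ℕ × ℕ → Set
Meets p q = Touches (proj₁ p) q ⊎ Touches (proj₂ p) q

common : ∀ {p q} → Meets p q → ∃ λ x → Touches x p × Touches x q
common (inj₁ t) = _ , inj₁ refl , t
common (inj₂ t) = _ , inj₂ refl , t

disjoint-red⇒2K2 : ∀ G (c : Colouring G) {k l} → c k ≡ true → c l ≡ true →
  ¬ Meets (lookup (E G) k) (lookup (E G) l) → HasCopy G c true twoK2
disjoint-red⇒2K2 G c {k} {l} ck cl ¬meets = f , f<V , f-injective
  , (k , inj₁ refl , ck) ∷ (l , inj₁ refl , cl) ∷ []
  where
  x = proj₁ (lookup (E G) k)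
  y = proj₂ (lookup (E G) k)
  z = proj₁ (lookup (E G) l)
  w = proj₂ (lookup (E G) l)
  x<y : x < y
  x<y = proj₁ (All.lookup (edgesOk G) (∈-lookup k))
  z<w : z < w
  z<w = proj₁ (All.lookup (edgesOk G) (∈-lookup l))
  f : ℕ → ℕ
  f 0 = x
  f 1 = y
  f 2 = z
  f _ = w
  f<V : ∀ a → a < 4 → f a < V G
  f<V 0 _ = proj₁ (edge-bounded G (∈-lookup k))
  f<V 1 _ = proj₂ (edge-bounded G (∈-lookup k))
  f<V 2 _ = proj₁ (edge-bounded G (∈-lookup l))
  f<V (suc (suc (suc _))) _ = proj₂ (edge-bounded G (∈-lookup l))
  f-distinct : ∀ a b → a < b → b < 4 → f a ≢ f b
  f-distinct 0 1 _ _ = <⇒≢ x<y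
  f-distinct 0 2 _ _ = ¬meets ∘ inj₁ ∘ inj₁
  f-distinct 0 3 _ _ = ¬meets ∘ inj₁ ∘ inj₂
  f-distinct 1 2 _ _ = ¬meets ∘ inj₂ ∘ inj₁
  f-distinct 1 3 _ _ = ¬meets ∘ inj₂ ∘ inj₂
  f-distinct 2 3 _ _ = <⇒≢ z<w
  f-distinct 1 1 (s≤s ()) _
  f-distinct (suc (suc _)) 1 (s≤s ()) _
  f-distinct (suc (suc _)) 2 (s≤s (s≤s ())) _
  f-distinct (suc (suc (suc _))) 3 (s≤s (s≤s (s≤s ()))) _
  f-distinct _ (suc (suc (suc (suc _)))) _ (s≤s (s≤s (s≤s (s≤s ()))))
  f-injective : ∀ a b → a < 4 → b < 4 → f a ≡ f b → a ≡ b
  f-injective a b a<4 b<4 eq with <-cmp a b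
  ... | tri< a<b _ _ = contradiction eq (f-distinct a b a<b b<4)
  ... | tri≈ _ a≡b _ = a≡b
  ... | tri> _ _ b<a = contradiction (sym eq) (f-distinct b a b<a a<4)

module _ (G : Graph) {M : ℕ} (3≤M : 3 ≤ M)
         (near : ∀ {x y} → (x , y) ∈ E G → Near M x y) (c : Colouring G) where

  private
    edge : Fin (size G) → ℕ × ℕ
    edge = lookup (E G)

    near± : ∀ k {x y} → edge k ≡ (x , y) ⊎ edge k ≡ (y , x) → Near± M x y
    near± k (inj₁ eq) = inj₁ (near (subst (_∈ E G) eq (∈-lookup k)))
    near± k (inj₂ eq) = inj₂ (near (subst (_∈ E G) eq (∈-lookup k)))

    red-missing? : ∀ v → Dec (∃ λ k → c k ≡ true × ¬ Touches v (edge k))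
    red-missing? v = any? λ k → (c k Bool.≟ true) ×-dec ¬? (touches? v (edge k))

    through : ∀ v → ¬ (∃ λ k → c k ≡ true × ¬ Touches v (edge k)) →
      ∀ k → c k ≡ true → Touches v (edge k)
    through v none k ck = decidable-stable (touches? v (edge k)) λ ¬t → none (k , ck , ¬t)

    meets-or-2K2 : ∀ k l → c k ≡ true → c l ≡ true →
      HasCopy G c true twoK2 ⊎ Meets (edge k) (edge l)
    meets-or-2K2 k l ck cl
      with touches? (proj₁ (edge k)) (edge l) ⊎-dec touches? (proj₂ (edge k)) (edge l)
    ... | yes meets = inj₂ meets
    ... | no ¬meets = inj₁ (disjoint-red⇒2K2 G c ck cl ¬meets)

    -- e = ab, g contains b but not a, h contains a but not b: the common vertex of g and h
    -- would complete a triangle.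
    ¬pairwise-meeting : ∀ e g h → ¬ Touches (proj₁ (edge e)) (edge g) → ¬ Touches (proj₂ (edge e)) (edge h) →
      Meets (edge e) (edge g) → Meets (edge e) (edge h) → ¬ Meets (edge g) (edge h)
    ¬pairwise-meeting e g h a∉g b∉h (inj₁ a∈g) _ _ = a∉g a∈g
    ¬pairwise-meeting e g h a∉g b∉h _ (inj₂ b∈h) _ = b∉h b∈h
    ¬pairwise-meeting e g h a∉g b∉h (inj₂ b∈g) (inj₁ a∈h) gh with common gh
    ... | x , x∈g , x∈h = triangle-free 3≤M (near± e (inj₁ refl))
      (near± g (touches-both (λ { refl → b∉h x∈h }) b∈g x∈g))
      (near± h (touches-both (λ { refl → a∉g x∈g }) a∈h x∈h))

  -- Take a red edge e. If neither of its ends is on all red edges, some red g misses one end and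
  -- some red h misses the other. Two of e, g, h are then disjoint, since otherwise they would form
  -- a triangle.
  2K2-or-star : HasCopy G c true twoK2 ⊎ ∃ λ v → ∀ k → c k ≡ true → Touches v (edge k)
  2K2-or-star with any? (λ k → c k Bool.≟ true)
  -- Without red edges every vertex is a centre; 0 is an arbitrary choice.
  ... | no none = inj₂ (0 , λ k ck → contradiction (k , ck) none)
  ... | yes (e , ce) with red-missing? (proj₁ (edge e)) | red-missing? (proj₂ (edge e))
  ...   | no none | _ = inj₂ (_ , through _ none)
  ...   | _ | no none = inj₂ (_ , through _ none)
  ...   | yes (g , cg , a∉g) | yes (h , ch , b∉h)
    with meets-or-2K2 e g ce cg | meets-or-2K2 e h ce ch | meets-or-2K2 g h cg ch
  ...     | inj₁ copy | _ | _ = inj₁ copy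
  ...     | _ | inj₁ copy | _ = inj₁ copy
  ...     | _ | _ | inj₁ copy = inj₁ copy
  ...     | inj₂ eg | inj₂ eh | inj₂ gh =
    ⊥-elim (¬pairwise-meeting e g h a∉g b∉h eg eh gh)

-- Arrowing from copies of nPₘ that avoid a given vertex.

∈-nP⁻ : ∀ n k {e} → e ∈ PE (nP n (suc k)) →
  ∃ λ i → ∃ λ j → i < n × j < k × e ≡ (i * suc k + j , i * suc k + suc j)
∈-nP⁻ n k e∈ with find (∈-concatMap⁻ _ {xs = upTo n} e∈)
... | i , i∈ , e∈′ with ∈-map⁻ _ e∈′
...   | j , j∈ , eq = i , j , ∈-upTo⁻ i∈ , ∈-upTo⁻ j∈ , eq

∈⇒Adj : ∀ G {x y} → (x , y) ∈ E G → Adj G x y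
∈⇒Adj G xy∈ = index xy∈ , inj₁ (sym (lookup-index xy∈))

-- The counterpart of `PackingAvoiding` for building copies, with the single vertex index of `nP`.
record EmbeddingAvoiding (G : Graph) (n k v : ℕ) : Set where
  field
    f         : ℕ → ℕ
    bounded   : ∀ a → a < n * suc k → f a < V G
    injective : ∀ a b → a < n * suc k → b < n * suc k → f a ≡ f b → a ≡ b
    avoids    : ∀ {a} → a < n * suc k → f a ≢ v
    adjacent  : ∀ {i j} → i < n → j < k → Adj G (f (i * suc k + j)) (f (i * suc k + suc j))

-- If there is no red 2K₂, all red edges share a vertex `v`, so a copy of nPₘ avoiding `v` is
-- entirely blue.
arrows : ∀ G n k {M} → 3 ≤ M → (∀ {x y} → (x , y) ∈ E G → Near M x y) →
  (∀ v → EmbeddingAvoiding G n k v) → Arrows G twoK2 (nP n (suc k))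
arrows G n k 3≤M near embed c with 2K2-or-star G 3≤M near c
... | inj₁ copy = inj₁ copy
... | inj₂ (v , centre) = inj₂ (f , bounded , injective , All.tabulate blue)
  where
  open EmbeddingAvoiding (embed v)
  blue : ∀ {e} → e ∈ PE (nP n (suc k)) → ∃ λ (l : Fin (size G)) →
    (lookup (E G) l ≡ (f (proj₁ e) , f (proj₂ e)) ⊎ lookup (E G) l ≡ (f (proj₂ e) , f (proj₁ e)))
    × c l ≡ false
  blue e∈ with ∈-nP⁻ n k e∈
  ... | i , j , i< , j< , refl with adjacent i< j<
  ...   | l , ends≡ = l , ends≡ , Bool.¬-not λ red →
    [ (λ eq → avoids (index-bounded i< (m<n⇒m<1+n j<)) (sym eq))
    , (λ eq → avoids (index-bounded i< (s≤s j<)) (sym eq)) ]′ (touches-copy ends≡ (centre l red))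

-- The host graph (n+1)Pₘ

length-concatMap : ∀ {A B : Set} {f : A → List B} {k} → (∀ x → length (f x) ≡ k) →
  ∀ xs → length (concatMap f xs) ≡ length xs * k
length-concatMap eq [] = refl
length-concatMap {f = f} eq (x ∷ xs) =
  trans (length-++ (f x)) (cong₂ _+_ (eq x) (length-concatMap eq xs))

paths : ℕ → ℕ → Graph
paths n k = record
  { V       = n * suc k
  ; E       = PE (nP n (suc k))
  ; edgesOk = All.tabulate ok
  ; simple  = Unique.concat⁺ (All.map⁺ (All.tabulate λ {i} _ → Unique.map⁺ (row-injective i) (Unique.upTo⁺ k)))
                (AllPairs.map⁺ (AllPairs.map rows-disjoint (Unique.upTo⁺ n)))
  }
  where
  ok : ∀ {e} → e ∈ PE (nP n (suc k)) → proj₁ e < proj₂ e × proj₂ e < n * suc k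
  ok e∈ with ∈-nP⁻ n k e∈
  ... | i , j , i< , j< , refl = +-monoʳ-< (i * suc k) (n<1+n j) , index-bounded i< (s≤s j<)
  edge : ℕ → ℕ → ℕ × ℕ
  edge i j = i * suc k + j , i * suc k + suc j
  row-injective : ∀ i {j j′} → edge i j ≡ edge i j′ → j ≡ j′
  row-injective i eq = +-cancelˡ-≡ (i * suc k) _ _ (cong proj₁ eq)
  rows-disjoint : ∀ {i i′} → i ≢ i′ → ∀ {e} →
    ¬ (e ∈ map (edge i) (upTo k) × e ∈ map (edge i′) (upTo k))
  rows-disjoint i≢i′ (e∈ , e∈′) with ∈-map⁻ _ e∈ | ∈-map⁻ _ e∈′
  ... | j , j∈ , refl | j′ , j′∈ , eq = i≢i′ (proj₁ (index-injective
    (m<n⇒m<1+n (∈-upTo⁻ j∈)) (m<n⇒m<1+n (∈-upTo⁻ j′∈)) (cong proj₁ eq)))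

size-paths : ∀ n k → size (paths n k) ≡ n * k
size-paths n k = trans
  (length-concatMap (λ i → trans (length-map _ (upTo k)) (length-upTo k)) (upTo n))
  (cong (_* k) (length-upTo n))

-- Skip the copy of Pₘ, number q, that contains v.
paths-avoiding : ∀ n k v → EmbeddingAvoiding (paths (suc n) k) n k v
paths-avoiding n k v = record
  { f = f ; bounded = bounded ; injective = injective ; avoids = λ {a} _ → avoids a ; adjacent = adjacent }
  where
  m = suc k
  q = v / m
  v<next : v < m + q * m
  v<next = subst (_< m + q * m) (sym (m≡m%n+[m/n]*n v m)) (+-monoˡ-< (q * m) (m%n<n v m))
  f : ℕ → ℕ
  f a with a <? q * m
  ... | yes _ = a
  ... | no  _ = m + a
  f-below : ∀ {a} → a < q * m → f a ≡ a
  f-below {a} a< with a <? q * m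
  ... | yes _ = refl
  ... | no a≮ = contradiction a< a≮
  f-above : ∀ {a} → q * m ≤ a → f a ≡ m + a
  f-above {a} a≥ with a <? q * m
  ... | yes a< = contradiction a≥ (<⇒≱ a<)
  ... | no _   = refl
  bounded : ∀ a → a < n * m → f a < suc n * m
  bounded a a< with a <? q * m
  ... | yes _ = <-≤-trans a< (m≤n+m (n * m) m)
  ... | no  _ = +-monoʳ-< m a<
  injective : ∀ a b → a < n * m → b < n * m → f a ≡ f b → a ≡ b
  injective a b _ _ eq with a <? q * m | b <? q * m
  ... | yes _  | yes _  = eq
  ... | no _   | no _   = +-cancelˡ-≡ m a b eq
  ... | yes a< | no b≮  = contradiction eq (<⇒≢ (<-≤-trans a< (≤-trans (≮⇒≥ b≮) (m≤n+m b m))))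
  ... | no a≮  | yes b< = contradiction (sym eq) (<⇒≢ (<-≤-trans b< (≤-trans (≮⇒≥ a≮) (m≤n+m a m))))
  avoids : ∀ a → f a ≢ v
  avoids a with a <? q * m
  ... | yes a< = <⇒≢ (<-≤-trans a< (m/n*n≤m v m))
  ... | no a≮  = ≢-sym (<⇒≢ (<-≤-trans v<next (+-monoʳ-≤ m (≮⇒≥ a≮))))
  adjacent : ∀ {i j} → i < n → j < k → Adj (paths (suc n) k) (f (i * m + j)) (f (i * m + suc j))
  adjacent {i} {j} i< j< with i <? q
  -- Both ends of an edge lie in the same copy of Pₘ, so either both stay in place or both shift by
  -- m.
  ... | yes i<q
    rewrite f-below (index-bounded i<q (m<n⇒m<1+n j<)) | f-below (index-bounded i<q (s≤s j<)) =
    ∈⇒Adj (paths (suc n) k) (∈-nP⁺ (m<n⇒m<1+n i<) j<)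
  ... | no i≮q
    rewrite f-above {i * m + j} (≤-trans (*-monoˡ-≤ m (≮⇒≥ i≮q)) (m≤m+n (i * m) j))
          | f-above {i * m + suc j} (≤-trans (*-monoˡ-≤ m (≮⇒≥ i≮q)) (m≤m+n (i * m) (suc j)))
          | sym (+-assoc m (i * m) j) | sym (+-assoc m (i * m) (suc j)) =
    ∈⇒Adj (paths (suc n) k) (∈-nP⁺ (s≤s i<) j<)

paths-arrows : ∀ n k → Arrows (paths (suc n) k) twoK2 (nP n (suc k))
-- Every edge here joins consecutive numbers, so any M ≥ 3 serves; 3 is the least.
paths-arrows n k = arrows (paths (suc n) k) n k {3} ≤-refl near (paths-avoiding n k)
  where
  near : ∀ {x y} → (x , y) ∈ PE (nP (suc n) (suc k)) → Near 3 x y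
  near xy∈ with ∈-nP⁻ (suc n) k xy∈
  ... | i , j , _ , _ , refl = inj₁ (+-suc (i * suc k) j)

-- The host cycle of length nm + 1

cycle : ∀ M → 3 ≤ M → Graph
cycle M 3≤M = record
  { V       = suc M
  ; E       = (0 , M) ∷ map (λ i → i , suc i) (upTo M)
  ; edgesOk = (≤-trans (s≤s z≤n) 3≤M , n<1+n M)
            ∷ All.map⁺ (All.tabulate λ {i} i∈ → n<1+n i , s≤s (∈-upTo⁻ i∈))
  ; simple  = All.map⁺ (All.tabulate λ _ → chord≢ 3≤M)
            ∷ Unique.map⁺ (cong proj₁) (Unique.upTo⁺ M)
  }
  where
  chord≢ : ∀ {M i} → 3 ≤ M → (0 , M) ≢ (i , suc i)
  chord≢ (s≤s ()) refl

size-cycle : ∀ M 3≤M → size (cycle M 3≤M) ≡ suc M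
size-cycle M _ = cong suc (trans (length-map _ (upTo M)) (length-upTo M))

-- Start the path at the successor of v; it passes from M to 0 after t steps.
-- For v > M the truncated t is 0, and f is the identity.
cycle-avoiding : ∀ n k 3≤M v → EmbeddingAvoiding (cycle (n * suc k) 3≤M) n k v
cycle-avoiding n k 3≤M v = record
  { f = f ; bounded = bounded ; injective = injective ; avoids = λ {a} → avoids a ; adjacent = adjacent }
  where
  m = suc k
  M = n * m
  C = cycle M 3≤M
  t = M ∸ v
  f : ℕ → ℕ
  f a with a <? t
  ... | yes _ = a + suc v
  ... | no  _ = a ∸ t
  f-below : ∀ {a} → a < t → f a ≡ a + suc v
  f-below {a} a< with a <? t
  ... | yes _ = refl
  ... | no a≮ = contradiction a< a≮
  f-above : ∀ {a} → t ≤ a → f a ≡ a ∸ t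
  f-above {a} a≥ with a <? t
  ... | yes a< = contradiction a≥ (<⇒≱ a<)
  ... | no _   = refl
  -- A position below `t` makes `t` positive, so `v` < `M` and the subtraction is exact.
  t+v : ∀ {a} → a < t → t + v ≡ M
  t+v a<t = m∸n+n≡m {M} {v} (<⇒≤ (m∸n≢0⇒n<m (m<n⇒n≢0 a<t)))
  below≤M : ∀ {a} → a < t → a + suc v ≤ M
  below≤M {a} a< = ≤-trans (≤-reflexive (+-suc a v))
    (≤-trans (+-monoˡ-≤ v a<) (≤-reflexive (t+v a<)))
  -- This follows from a < M ≤ v + t.
  above<v : ∀ {a} → a < M → t ≤ a → a ∸ t < v
  above<v {a} a< t≤a = +-cancelʳ-< t (a ∸ t) v
    (subst (_< v + t) (sym (m∸n+n≡m t≤a)) (<-≤-trans a< (m≤n+m∸n M v)))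
  bounded : ∀ a → a < M → f a < suc M
  bounded a a<M with a <? t
  ... | yes a< = s≤s (below≤M a<)
  ... | no  _  = m<n⇒m<1+n (≤-<-trans (m∸n≤m a t) a<M)
  avoids : ∀ a → a < M → f a ≢ v
  avoids a a<M with a <? t
  ... | yes _ = ≢-sym (<⇒≢ (m≤n+m (suc v) a))
  ... | no a≮ = <⇒≢ (above<v a<M (≮⇒≥ a≮))
  injective : ∀ a b → a < M → b < M → f a ≡ f b → a ≡ b
  injective a b a<M b<M eq with a <? t | b <? t
  ... | yes _ | yes _  = +-cancelʳ-≡ (suc v) a b eq
  ... | no a≮ | no b≮  = ∸-cancelʳ-≡ (≮⇒≥ a≮) (≮⇒≥ b≮) eq
  ... | yes _ | no b≮  = contradiction (sym eq) (<⇒≢ (<-trans (above<v b<M (≮⇒≥ b≮)) (m≤n+m (suc v) a)))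
  ... | no a≮ | yes _  = contradiction eq (<⇒≢ (<-trans (above<v a<M (≮⇒≥ a≮)) (m≤n+m (suc v) b)))
  step : ∀ {x} → x < M → Adj C x (suc x)
  step x< = ∈⇒Adj C (there (∈-map⁺ _ (∈-upTo⁺ x<)))
  consecutive : ∀ a → suc a < M → Adj C (f a) (f (suc a))
  consecutive a 1+a<M with <-cmp (suc a) t
  ... | tri< 1+a<t _ _ rewrite f-below (<-trans (n<1+n a) 1+a<t) | f-below 1+a<t =
    step (below≤M 1+a<t)
  -- Here the path passes from M to 0 through the chord.
  ... | tri≈ _ 1+a≡t _ = Adj-sym C (∈⇒Adj C (here (cong₂ _,_ fsa≡0 fa≡M)))
    where
    a<t : a < t
    a<t = ≤-reflexive 1+a≡t
    fsa≡0 : f (suc a) ≡ 0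
    fsa≡0 = trans (f-above (≤-reflexive (sym 1+a≡t))) (m≤n⇒m∸n≡0 a<t)
    fa≡M : f a ≡ M
    fa≡M = trans (f-below a<t) (trans (+-suc a v) (trans (cong (_+ v) 1+a≡t) (t+v a<t)))
  ... | tri> _ _ t<1+a rewrite f-above (≤-pred t<1+a) | f-above (<⇒≤ t<1+a)
                             | +-∸-assoc 1 (≤-pred t<1+a) =
    step (≤-<-trans (m∸n≤m a t) (<-trans (n<1+n a) 1+a<M))
  adjacent : ∀ {i j} → i < n → j < k → Adj C (f (i * m + j)) (f (i * m + suc j))
  adjacent {i} {j} i< j< = subst (λ b → Adj C (f (i * m + j)) (f b)) (sym (+-suc (i * m) j))
    (consecutive (i * m + j) (subst (_< M) (+-suc (i * m) j) (index-bounded i< (s≤s j<))))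

cycle-arrows : ∀ n k 3≤M → Arrows (cycle (n * suc k) 3≤M) twoK2 (nP n (suc k))
cycle-arrows n k 3≤M = arrows (cycle M 3≤M) n k 3≤M near (cycle-avoiding n k 3≤M)
  where
  M = n * suc k
  near : ∀ {x y} → (x , y) ∈ E (cycle M 3≤M) → Near M x y
  near (here refl) = inj₂ (refl , refl)
  near (there xy∈) with ∈-map⁻ _ xy∈
  ... | _ , _ , refl = inj₁ refl

-- For n = 1 and m = 2 the cycle would be a triangle, but there (n+1)Pₘ is smaller.
cycle-long-enough : ∀ n k → 1 ≤ n → suc (n * suc k) ≤ suc n * k → 3 ≤ n * suc k
cycle-long-enough n zero 1≤n le with () ← subst (suc (n * 1) ≤_) (*-zeroʳ n) le
-- For m = 2 the hypothesis reads 2n + 1 ≤ n + 1.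
cycle-long-enough n (suc zero) 1≤n le =
  contradiction (≤-pred le) (<⇒≱ (*-monoʳ-< n {{>-nonZero 1≤n}} {1} {2} ≤-refl))
cycle-long-enough n (suc (suc k)) 1≤n le =
  ≤-trans (s≤s (s≤s (s≤s z≤n))) (*-monoˡ-≤ (3 + k) 1≤n)

-- The smaller of the two hosts meets the lower bound.

theorem6 : ∀ (n m : ℕ) → 1 ≤ n → 2 ≤ m →
    IsSizeRamsey twoK2 (nP n m) ((n * m + 1) ⊓ ((n + 1) * (m ∸ 1)))
theorem6 n (suc k) 1≤n (s≤s 1≤k) rewrite +-comm (n * suc k) 1 | +-comm n 1 = host , minimal
  where
  host : Σ Graph λ G → size G ≡ suc (n * suc k) ⊓ (suc n * k) × Arrows G twoK2 (nP n (suc k))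
  host with ≤-total (suc (n * suc k)) (suc n * k)
  -- The comparison that selects the cycle also ensures that it is no triangle.
  ... | inj₁ le = cycle (n * suc k) 3≤M
                , trans (size-cycle (n * suc k) 3≤M) (sym (m≤n⇒m⊓n≡m le)) , cycle-arrows n k 3≤M
    where 3≤M = cycle-long-enough n k 1≤n le
  ... | inj₂ ge = paths (suc n) k
                , trans (size-paths (suc n) k) (sym (m≥n⇒m⊓n≡n ge)) , paths-arrows n k
  minimal : ∀ G → size G < suc (n * suc k) ⊓ (suc n * k) → ¬ Arrows G twoK2 (nP n (suc k))
  minimal G small = lower-bound G n k 1≤n 1≤k
    (≤-pred (<-≤-trans small (m⊓n≤m _ (suc n * k)))) (<-≤-trans small (m⊓n≤n (suc (n * suc k)) _))
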